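{- Let $k,q\ge1$ be integers and let $X$, the residues $\alpha_1,\dots,\alpha_q\in\mathbb Z_\ell$, the graphs $J_{i,a}$ and the partitions $E_{i,a}$ ($i\in[k]$, $a\in[q]$) be as defined in the context. For every $(a_1,\dots,a_k)\in[q]^k$, \[ \bigvee_{i=1}^k E_{i,a_i}\neq\mathbf 1_X . \] Equivalently, the graph $\bigcup_{i=1}^k J_{i,a_i}$ on vertex set $X$ is disconnected.
   Context: Partitions of a finite set $W$ are ordered by refinement ($\pi\preceq\sigma$ iff every block of $\pi$ is contained in a block of $\sigma$); the join $\bigvee$ of a family is the finest partition coarser than all its members; $\mathbf 1_W=\{W\}$ is the one-block partition. For a graph $H$ on vertex set $W$ (isolated vertices allowed), $\mathrm{cc}(H)$ is the partition of $W$ into connected components of $H$. The union of graphs on the same vertex set is the graph with the union of the edge sets. $[m]=\{1,\dots,m\}$. Construction (additive-shift verifier). Let $M_0=\max\{q,2^k\}$ and let $\ell$ be a prime with $M_0<\ell<2M_0$. Let $\alpha_1,\dots,\alpha_q\in\mathbb Z_\ell$ be pairwise distinct residues. Let $X=\{\bot\}\cup(2^{[k]}\times\mathbb Z_\ell)$, where $\bot$ is an extra point. For $i\in[k]$ and $a\in[q]$, $J_{i,a}$ is the graph on $X$ with exactly the following edges: (1) for every $S\subseteq[k]$, the edge between $\bot$ and $(S,0)$; (2) for every $S\subseteq[k]\setminus\{i\}$ and every $t\in\mathbb Z_\ell$, the edge between $(S,t)$ and $(S\cup\{i\},t+\alpha_a)$ (addition modulo $\ell$). Put $E_{i,a}=\mathrm{cc}(J_{i,a})$.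 -}

module Defs where

open import Data.Fin using (Fin; toℕ)
open import Data.Fin.Subset using (Subset; _∈_; _∉_; _∪_; ⁅_⁆)
open import Data.Fin.Subset.Properties using (x∈⁅x⁆; q⊆p∪q)
open import Data.Nat using (ℕ; NonZero; _+_; _⊔_; _^_)
open import Data.Nat.DivMod using (_mod_)
open import Data.Product using (∃; _,_; proj₁)
open import Data.Unit using (⊤)
open import Level using (0ℓ)
open import Relation.Binary.Core using (Rel; _⇔_)
open import Relation.Binary.Construct.Closure.ReflexiveTransitive
  using (Star; ε; _◅◅_; reverse; return; fold)
open import Relation.Binary.Construct.Closure.Symmetric as Sym
  using (SymClosure; fwd; bwd)
open import Relation.Binary.Definitions using (Irreflexive; Symmetric)
open import Relation.Binary.PropositionalEquality using (_≡_; refl; sym; subst)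
open import Relation.Binary.Structures using (IsEquivalence)
open import Relation.Nullary using (¬_)
open import Relation.Unary using (Pred; _⊆_)

-- A partition is given by the equivalence relation "lies in the same block";
-- its blocks are the equivalence classes.
record Partition (W : Set) : Set₁ where
  field
    _∼_           : Rel W 0ℓ
    isEquivalence : IsEquivalence _∼_

  block : W → Pred W 0ℓ
  block x y = x ∼ y

  open IsEquivalence isEquivalence public
    renaming (refl to ∼-refl; sym to ∼-sym; trans to ∼-trans)
    using ()

open Partition using (block)

infix 4 _≋_ _≉_ _⪯_

-- Two partitions are equal when they have the same blocks.
_≋_ _≉_ : ∀ {W} → Partition W → Partition W → Set
π ≋ σ = Partition._∼_ π ⇔ Partition._∼_ σ
π ≉ σ = ¬ (π ≋ σ)

_⪯_ : ∀ {W} → Partition W → Partition W → Set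
π ⪯ σ = ∀ x → ∃ λ y → block π x ⊆ block σ y

𝟏 : (W : Set) → Partition W
𝟏 W = record
  { _∼_           = λ _ _ → ⊤
  ; isEquivalence = record { refl = _ ; sym = _ ; trans = _ }
  }

record IsJoin {W I : Set} (π : I → Partition W) (σ : Partition W) : Set₁ where
  field
    upper : ∀ i → π i ⪯ σ
    least : ∀ τ → (∀ i → π i ⪯ τ) → σ ⪯ τ

join : ∀ {W I} (π : I → Partition W) → ∃ (IsJoin π)
join {W} {I} π = σ , record { upper = upper ; least = least }
  where
  Step : Rel W 0ℓ
  Step x y = ∃ λ i → block (π i) x y

  σ : Partition W
  σ = record
    { _∼_           = Star Step
    ; isEquivalence = record
      { refl  = ε
      ; sym   = reverse λ (i , p) → i , Partition.∼-sym (π i) p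
      ; trans = _◅◅_
      }
    }

  upper : ∀ i → π i ⪯ σ
  upper i x = x , λ p → return (i , p)

  least : ∀ τ → (∀ i → π i ⪯ τ) → σ ⪯ τ
  least τ π⪯τ x = x , fold (Partition._∼_ τ) (λ s → ∼-trans (step s)) ∼-refl
    where
    open Partition τ
    step : ∀ {u v} → Step u v → u ∼ v
    step {u} (i , p) =
      let _ , B⊆C = π⪯τ i u
      in ∼-trans (∼-sym (B⊆C (Partition.∼-refl (π i)))) (B⊆C p)

⋁ : ∀ {W I} → (I → Partition W) → Partition W
⋁ π = proj₁ (join π)

record Graph (W : Set) : Set₁ where
  field
    Adj       : Rel W 0ℓ
    symmetric : Symmetric Adj
    loopless  : Irreflexive _≡_ Adj

  Walk : Rel W 0ℓ
  Walk = Star Adj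

  Connected Disconnected : Set
  Connected    = ∀ u v → Walk u v
  Disconnected = ¬ Connected

open Graph using (Disconnected) public

cc : ∀ {W} → Graph W → Partition W
cc H = record
  { _∼_           = Graph.Walk H
  ; isEquivalence = record
    { refl  = ε
    ; sym   = reverse (Graph.symmetric H)
    ; trans = _◅◅_
    }
  }

⋃ : ∀ {W I} → (I → Graph W) → Graph W
⋃ H = record
  { Adj       = λ u v → ∃ λ i → Graph.Adj (H i) u v
  ; symmetric = λ (i , e) → i , Graph.symmetric (H i) e
  ; loopless  = λ u≡v (i , e) → Graph.loopless (H i) u≡v e
  }

M₀ : ℕ → ℕ → ℕ
M₀ k q = q ⊔ 2 ^ k

-- Residues modulo ℓ, represented by 0, …, ℓ - 1.
ℤ/ : ℕ → Set
ℤ/ ℓ = Fin ℓ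

module _ {ℓ : ℕ} .{{_ : NonZero ℓ}} where

  infixl 6 _⊕_

  0# : ℤ/ ℓ
  0# = 0 mod ℓ

  _⊕_ : ℤ/ ℓ → ℤ/ ℓ → ℤ/ ℓ
  s ⊕ t = (toℕ s + toℕ t) mod ℓ

data X (k ℓ : ℕ) : Set where
  bot  : X k ℓ
  node : Subset k → ℤ/ ℓ → X k ℓ

module _ {k q ℓ : ℕ} .{{_ : NonZero ℓ}} (α : Fin q → ℤ/ ℓ) (i : Fin k) (a : Fin q) where

  data Edge : Rel (X k ℓ) 0ℓ where
    spoke : ∀ S → Edge bot (node S 0#)
    shift : ∀ S t → i ∉ S → Edge (node S t) (node (S ∪ ⁅ i ⁆) (t ⊕ α a))

  private
    node-injectiveˡ : ∀ {S T : Subset k} {s t : ℤ/ ℓ} → node S s ≡ node T t → S ≡ T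
    node-injectiveˡ refl = refl

    Edge-loopless : Irreflexive _≡_ Edge
    Edge-loopless () (spoke S)
    Edge-loopless eq (shift S t i∉S) =
      i∉S (subst (λ T → i ∈ T) (sym (node-injectiveˡ eq))
            (q⊆p∪q S ⁅ i ⁆ (x∈⁅x⁆ i)))

  J : Graph (X k ℓ)
  J = record
    { Adj       = SymClosure Edge
    ; symmetric = Sym.symmetric Edge
    ; loopless  = λ { eq (fwd e) → Edge-loopless eq e
                    ; eq (bwd e) → Edge-loopless (sym eq) e }
    }

  E : Partition (X k ℓ)
  E = cc J

{-# OPTIONS --safe #-}

-- Let σ(S) be the sum of the shifts α_{a i} over i ∈ S.  Along a shift edge the
-- residue t − σ(S) of (S , t) does not change, so a walk from (∅ , c) that
-- reaches ⊥ for the first time through (S , 0) forces c + σ(S) ≡ 0 (mod ℓ).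
-- If the graph were connected, choosing such an S for every residue c would
-- give an injection from ℤ/ℓ into the 2^k subsets of [k], against 2^k < ℓ.
module Submission where

open import Defs
open import Data.Bool using (true; false)
open import Data.Empty using (⊥-elim)
open import Data.Fin using (Fin; zero; suc; toℕ; combine)
open import Data.Fin.Properties
  using (2↔Bool; combine-injective; pigeonhole; toℕ-fromℕ<; toℕ-injective; toℕ<n; <⇒≢)
open import Data.Fin.Subset using (Subset; _∉_; _∪_; ⁅_⁆; ⊥)
open import Data.Fin.Subset.Properties using (∪-identityʳ)
open import Data.Nat using (ℕ; NonZero; _+_; _^_; _%_; _/_; _≤_; _<_; _*_)
open import Data.Nat.DivMod
  using (_mod_; m%n<n; m≡m%n+[m/n]*n; [m+kn]%n≡m%n; m<n⇒m%n≡m)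
open import Data.Nat.Primality using (Prime; prime⇒nonZero)
open import Data.Nat.Properties using (+-comm; +-cancelʳ-≡; m≤n⊔m; ≤-<-trans)
open import Data.Nat.Tactic.RingSolver using (solve-∀)
open import Data.Product using (_×_; _,_; ∃; ∃₂; proj₁; proj₂)
open import Data.Vec using ([]; _∷_; here; there)
open import Function using (_∘_; id; Inverse)
open import Function.Definitions using (Injective)
open import Relation.Binary.Construct.Closure.ReflexiveTransitive using (ε; _◅_; _◅◅_; gmap; fold)
open import Relation.Binary.Construct.Closure.Symmetric using (fwd; bwd)
open import Relation.Binary.PropositionalEquality
  using (_≡_; refl; sym; trans; cong; cong₂; subst; module ≡-Reasoning)
open import Relation.Nullary using (¬_)

-- The membership vector is read as binary digits, which makes subsets accessible to `pigeonhole`, a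
-- statement about `Fin`.
encode : ∀ {k} → Subset k → Fin (2 ^ k)
encode []      = zero
encode (b ∷ S) = combine (Inverse.from 2↔Bool b) (encode S)

encode-injective : ∀ {k} → Injective _≡_ _≡_ (encode {k})
encode-injective {x = []}    {[]}    _  = refl
encode-injective {x = b ∷ S} {c ∷ T} eq =
  let p , r = combine-injective (Inverse.from 2↔Bool b) (encode S) (Inverse.from 2↔Bool c) (encode T) eq
  in cong₂ _∷_ (trans (sym (Inverse.strictlyInverseˡ 2↔Bool b))
                 (trans (cong (Inverse.to 2↔Bool) p) (Inverse.strictlyInverseˡ 2↔Bool c)))
               (encode-injective r)

subset-pigeonhole : ∀ {k n} → 2 ^ k < n → (f : Fin n → Subset k) → ¬ Injective _≡_ _≡_ f
subset-pigeonhole 2^k<n f f-inj =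
  let i , j , i<j , eq = pigeonhole 2^k<n (encode ∘ f)
  in <⇒≢ i<j (f-inj (encode-injective eq))

-- The sum is kept in ℕ, unreduced, so that enlarging `S` changes it by an exact equation; reduction
-- modulo `ℓ` enters only through `_⊕_`.
weight : ∀ {k} → (Fin k → ℕ) → Subset k → ℕ
weight w []          = 0
weight w (true ∷ S)  = w zero + weight (w ∘ suc) S
weight w (false ∷ S) = weight (w ∘ suc) S

weight-∪⁅⁆ : ∀ {k} (w : Fin k → ℕ) (S : Subset k) {i} → i ∉ S →
             weight w (S ∪ ⁅ i ⁆) ≡ w i + weight w S
weight-∪⁅⁆ w (true ∷ S)  {zero}  0∉S = ⊥-elim (0∉S here)
weight-∪⁅⁆ w (false ∷ S) {zero}  _   = cong (λ T → w zero + weight (w ∘ suc) T) (∪-identityʳ S)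
weight-∪⁅⁆ w (false ∷ S) {suc i} i∉S = weight-∪⁅⁆ (w ∘ suc) S (i∉S ∘ there)
weight-∪⁅⁆ w (true ∷ S)  {suc i} i∉S =
  trans (cong (w zero +_) (weight-∪⁅⁆ (w ∘ suc) S (i∉S ∘ there)))
        (swap (w zero) (w (suc i)) (weight (w ∘ suc) S))
  where
  swap : ∀ x y z → x + (y + z) ≡ y + (x + z)
  swap = solve-∀

exchange : ∀ x y z → (x + y) + z ≡ (x + z) + y
exchange = solve-∀

-- Congruence modulo ℓ with both sides moved up, so that no subtraction occurs
-- and common summands cancel in ℕ.
infix 4 _≡_[mod_]
_≡_[mod_] : ℕ → ℕ → ℕ → Set
x ≡ y [mod ℓ ] = ∃₂ λ m n → x + m * ℓ ≡ y + n * ℓ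

module _ {ℓ : ℕ} where

  mod-sym : ∀ {x y} → x ≡ y [mod ℓ ] → y ≡ x [mod ℓ ]
  mod-sym (m , n , eq) = n , m , sym eq

  mod-trans : ∀ {x y z} → x ≡ y [mod ℓ ] → y ≡ z [mod ℓ ] → x ≡ z [mod ℓ ]
  mod-trans {x} {y} {z} (m , n , p) (m′ , n′ , r) = m + m′ , n′ + n , (begin
    x + (m + m′) * ℓ       ≡⟨ split x m m′ ℓ ⟩
    (x + m * ℓ) + m′ * ℓ   ≡⟨ cong (_+ m′ * ℓ) p ⟩
    (y + n * ℓ) + m′ * ℓ   ≡⟨ exchange y (n * ℓ) (m′ * ℓ) ⟩
    (y + m′ * ℓ) + n * ℓ   ≡⟨ cong (_+ n * ℓ) r ⟩
    (z + n′ * ℓ) + n * ℓ   ≡⟨ split z n′ n ℓ ⟨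
    z + (n′ + n) * ℓ       ∎)
    where
    open ≡-Reasoning
    split : ∀ a b c d → a + (b + c) * d ≡ (a + b * d) + c * d
    split = solve-∀

  mod-+ʳ : ∀ {x y} z → x ≡ y [mod ℓ ] → x + z ≡ y + z [mod ℓ ]
  mod-+ʳ {x} {y} z (m , n , eq) =
    m , n , trans (exchange x z (m * ℓ)) (trans (cong (_+ z) eq) (exchange y (n * ℓ) z))

  mod-cancelʳ : ∀ {x y} z → x + z ≡ y + z [mod ℓ ] → x ≡ y [mod ℓ ]
  mod-cancelʳ {x} {y} z (m , n , eq) =
    m , n , +-cancelʳ-≡ z _ _ (trans (exchange x (m * ℓ) z) (trans eq (exchange y z (n * ℓ))))

module _ {ℓ : ℕ} .{{_ : NonZero ℓ}} where

  toℕ-mod : ∀ x → toℕ (x mod ℓ) ≡ x [mod ℓ ]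
  toℕ-mod x = x / ℓ , 0 , trans (cong (_+ x / ℓ * ℓ) (toℕ-fromℕ< (m%n<n x ℓ)))
                            (trans (sym (m≡m%n+[m/n]*n x ℓ)) (+-comm 0 x))

  -- Representatives lie below `ℓ`, so each is its own remainder.
  toℕ-mod-injective : ∀ {s t : ℤ/ ℓ} → toℕ s ≡ toℕ t [mod ℓ ] → s ≡ t
  toℕ-mod-injective {s} {t} (m , n , eq) = toℕ-injective (begin
    toℕ s                ≡⟨ m<n⇒m%n≡m (toℕ<n s) ⟨
    toℕ s % ℓ            ≡⟨ [m+kn]%n≡m%n (toℕ s) m ℓ ⟨
    (toℕ s + m * ℓ) % ℓ  ≡⟨ cong (_% ℓ) eq ⟩
    (toℕ t + n * ℓ) % ℓ  ≡⟨ [m+kn]%n≡m%n (toℕ t) n ℓ ⟩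
    toℕ t % ℓ            ≡⟨ m<n⇒m%n≡m (toℕ<n t) ⟩
    toℕ t                ∎)
    where open ≡-Reasoning

-- Each step of a chain in the join is a walk inside a single `H i`; these walks concatenate in the
-- union. This carries disconnectedness of the union over to the join.
⋁cc⇒Walk-⋃ : ∀ {W I : Set} (H : I → Graph W) {u v} →
             Partition._∼_ (⋁ (cc ∘ H)) u v → Graph.Walk (⋃ H) u v
⋁cc⇒Walk-⋃ H = fold (Graph.Walk (⋃ H)) (λ (i , p) → gmap id (i ,_) p ◅◅_) ε

module _ {k q ℓ : ℕ} .{{_ : NonZero ℓ}} (α : Fin q → ℤ/ ℓ) (a : Fin k → Fin q) where

  private
    G : Graph (X k ℓ)
    G = ⋃ (λ i → J α i (a i))

    σ : Subset k → ℕ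
    σ = weight (toℕ ∘ α ∘ a)

    -- The reduction inside `_⊕_` costs only a multiple of `ℓ`. The shift `u` is moved to the end,
    -- where it can be added or cancelled on the right.
    ⊕-mod : ∀ (t u : ℤ/ ℓ) r → toℕ (t ⊕ u) + r ≡ (toℕ t + r) + toℕ u [mod ℓ ]
    ⊕-mod t u r = subst (toℕ (t ⊕ u) + r ≡_[mod ℓ ]) (exchange (toℕ t) (toℕ u) r)
                    (mod-+ʳ r (toℕ-mod (toℕ t + toℕ u)))

    σ-∪⁅⁆ : ∀ S {i} → i ∉ S → σ (S ∪ ⁅ i ⁆) ≡ σ S + toℕ (α (a i))
    σ-∪⁅⁆ S i∉S = trans (weight-∪⁅⁆ _ S i∉S) (+-comm _ (σ S))

  -- S′ is the subset through which the walk first enters ⊥.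
  walk-to-bot : ∀ {S t} → Graph.Walk G (node S t) bot → ∃ λ S′ → toℕ t + σ S′ ≡ σ S [mod ℓ ]
  -- Here `t` is `0#`, and whatever the walk does after entering `bot` is ignored.
  walk-to-bot ((i , bwd (spoke S)) ◅ _) = S , mod-+ʳ (σ S) (toℕ-mod 0)
  -- The edge adds the same shift to the residue and to `σ S`, so it cancels from the congruence for
  -- the rest of the walk.
  walk-to-bot ((i , fwd (shift S t i∉S)) ◅ p) =
    let S′ , eq = walk-to-bot p in
    S′ , mod-cancelʳ (toℕ (α (a i)))
           (mod-trans (mod-sym (⊕-mod t (α (a i)) (σ S′)))
             (subst (toℕ (t ⊕ α (a i)) + σ S′ ≡_[mod ℓ ]) (σ-∪⁅⁆ S i∉S) eq))
  -- Traversed backwards, the edge removes the shift from both; it is added back to the two sides.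
  walk-to-bot ((i , bwd (shift S t i∉S)) ◅ p) =
    let S′ , eq = walk-to-bot p in
    S′ , subst (toℕ (t ⊕ α (a i)) + σ S′ ≡_[mod ℓ ]) (sym (σ-∪⁅⁆ S i∉S))
           (mod-trans (⊕-mod t (α (a i)) (σ S′)) (mod-+ʳ (toℕ (α (a i))) eq))

  ⋃J-disconnected : 2 ^ k < ℓ → Disconnected G
  ⋃J-disconnected 2^k<ℓ connected = subset-pigeonhole 2^k<ℓ (proj₁ ∘ exit) exit-injective
    where
    -- `⊥` is the empty subset. Its weight can stay unevaluated, since only its independence of `c`
    -- matters.
    exit : ∀ c → ∃ λ S → toℕ c + σ S ≡ σ ⊥ [mod ℓ ]
    exit c = walk-to-bot (connected (node ⊥ c) bot)

    exit-injective : Injective _≡_ _≡_ (proj₁ ∘ exit)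
    -- With a common exit `S`, both `c` and `d` plus `σ S` are congruent to `σ ⊥`, and `σ S`
    -- cancels.
    exit-injective {c} {d} eq = toℕ-mod-injective (mod-cancelʳ (σ (proj₁ (exit c)))
      (mod-trans (proj₂ (exit c))
        (mod-sym (subst (λ S → toℕ d + σ S ≡ σ ⊥ [mod ℓ ]) (sym eq) (proj₂ (exit d))))))

lemma3p4 : (k q : ℕ) → 1 ≤ k → 1 ≤ q →
    (ℓ : ℕ) (ℓ-prime : Prime ℓ) → M₀ k q < ℓ → ℓ < 2 * M₀ k q →
    (α : Fin q → ℤ/ ℓ) → Injective _≡_ _≡_ α →
    (a : Fin k → Fin q) →
    let instance _ = prime⇒nonZero ℓ-prime in
    (⋁ (λ i → E α i (a i)) ≉ 𝟏 (X k ℓ)) × Disconnected (⋃ (λ i → J α i (a i)))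
lemma3p4 k q _ _ ℓ ℓ-prime M₀<ℓ _ α _ a =
  -- Equality with `𝟏` puts any two points in one block of the join, hence on a walk in the union.
  (λ (_ , total) → disconnected λ u v → ⋁cc⇒Walk-⋃ (λ i → J α i (a i)) (total _)) , disconnected
  where
  instance _ = prime⇒nonZero ℓ-prime

  disconnected : Disconnected (⋃ (λ i → J α i (a i)))
  disconnected = ⋃J-disconnected α a (≤-<-trans (m≤n⊔m q (2 ^ k)) M₀<ℓ)
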